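{- For every integer $n\ge 2$, the cocktail party graph $CP_n$ on $2n$ vertices is a convex-round permutation graph with $\chi(CP_n)+2\le \chi_{\mathrm{o}}(CP_n)$.
   Context: $CP_n$ is the graph obtained from the complete graph $K_{2n}$ on vertex set $\{0,\dots,2n-1\}$ by removing the perfect matching $\{\{2i,2i+1\} : i\in\{0,\dots,n-1\}\}$. A graph is convex-round if its vertices have a circular ordering such that the (open) neighborhood of every vertex is an interval of the circular ordering. A permutation graph is an intersection graph of segments having their two endpoints on two parallel lines, one on each (equivalently, the comparability graph of a poset of dimension at most two). $\chi$ is the chromatic number. A proper odd coloring is a proper vertex coloring in which for every non-isolated vertex some color appears an odd number of times in its open neighborhood; $\chi_{\mathrm{o}}$ is the least number of colors in such a coloring. -}

module Defs where

open import Data.Fin using (Fin; toℕ; finToFun; funToFin)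
open import Data.Fin.Permutation using (Permutation′; _⟨$⟩ʳ_)
open import Data.Fin.Properties using (_≟_; all?; any?; nonZeroIndex; finToFun-funToFin)
open import Data.Fin.Subset using (Subset; _∈_; _∩_; ∣_∣; ⁅_⁆)
open import Data.Fin.Subset.Properties
  using (⊆-antisym; x∈⁅x⁆; x∈⁅y⁆⇒x≡y; x∈p∩q⁺; x∈p∩q⁻; ∣⁅x⁆∣≡1)
open import Data.Nat using (ℕ; zero; suc; _+_; _*_; _≤_; _<_; z≤n; s≤s)
import Data.Nat.Properties as ℕ
open import Data.Nat.Divisibility using (_∣_; _∣?_; ∣1⇒≡1)
open import Data.Nat.DivMod using (_mod_)
open import Data.Product using (∃; ∃-syntax; Σ-syntax; _×_; _,_; proj₁; proj₂)
open import Data.Rational as ℚ using (ℚ; 0ℚ; 1ℚ)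
open import Data.Sum using (_⊎_)
import Data.Sum as Sum
open import Data.Vec using (tabulate)
open import Data.Vec.Properties using (lookup∘tabulate; lookup⇒[]=; []=⇒lookup)
open import Function using (_∘_; id)
open import Function.Bundles using (_⇔_)
open import Level using (0ℓ)
open import Relation.Binary using (Rel; Symmetric; Irreflexive; Decidable)
open import Relation.Binary.PropositionalEquality
  using (_≡_; _≢_; refl; sym; trans; cong; subst)
open import Relation.Nullary using (Dec; yes; no; ¬_; does; contradiction)
open import Relation.Nullary.Decidable using (map′; ¬?; _×-dec_; _⊎-dec_; _→-dec_; dec-true)
import Relation.Unary as U

record Graph (n : ℕ) : Set₁ where
  field
    _~_     : Rel (Fin n) 0ℓ
    _~?_    : Decidable _~_
    ~-sym   : Symmetric _~_
    ~-irrefl : Irreflexive _≡_ _~_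

K : ∀ n → Graph n
K n = record
  { _~_      = _≢_
  ; _~?_     = λ u v → ¬? (u ≟ v)
  ; ~-sym    = λ u≢v v≡u → u≢v (sym v≡u)
  ; ~-irrefl = λ u≡v u≢v → u≢v u≡v
  }

removeEdges : ∀ {n} (G : Graph n) (M : Rel (Fin n) 0ℓ) →
              Decidable M → Symmetric M → Graph n
removeEdges G M M? M-sym = record
  { _~_      = λ u v → u ~ v × ¬ M u v
  ; _~?_     = λ u v → (u ~? v) ×-dec ¬? (M? u v)
  ; ~-sym    = λ (u~v , ¬Muv) → ~-sym u~v , ¬Muv ∘ M-sym
  ; ~-irrefl = λ u≡v (u~v , _) → ~-irrefl u≡v u~v
  }
  where open Graph G

Matched : ∀ n → Rel (Fin (2 * n)) 0ℓ
Matched n u v = ∃[ i ] (IsPair i u v ⊎ IsPair i v u)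
  where
  IsPair : Fin n → Rel (Fin (2 * n)) 0ℓ
  IsPair i u v = toℕ u ≡ 2 * toℕ i × toℕ v ≡ 2 * toℕ i + 1

matched? : ∀ n → Decidable (Matched n)
matched? n u v = any? λ i →
  ((toℕ u ℕ.≟ 2 * toℕ i) ×-dec (toℕ v ℕ.≟ 2 * toℕ i + 1)) ⊎-dec
  ((toℕ v ℕ.≟ 2 * toℕ i) ×-dec (toℕ u ℕ.≟ 2 * toℕ i + 1))

matched-sym : ∀ n → Symmetric (Matched n)
matched-sym n (i , p) = i , Sum.swap p

CP : ∀ n → Graph (2 * n)
CP n = removeEdges (K (2 * n)) (Matched n) (matched? n) (matched-sym n)

-- Arcs wrap around modulo n; the empty arc (ℓ = 0) and the whole cycle are
-- allowed.
OnArc : ∀ {n} → Fin n → ℕ → Fin n → Set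
OnArc {n} s ℓ p = ∃[ i ] i < ℓ × p ≡ (toℕ s + i) mod n
  where instance _ = nonZeroIndex s

IsCircularInterval : ∀ {n} → (Fin n → Fin n) → (Fin n → Set) → Set
IsCircularInterval pos S = ∃[ s ] ∃[ ℓ ] (∀ u → S u ⇔ OnArc s ℓ (pos u))

-- The permutation sends a vertex to its position on the cycle.
ConvexRound : ∀ {n} → Graph n → Set
ConvexRound {n} G =
  Σ[ π ∈ Permutation′ n ] (∀ v → IsCircularInterval (π ⟨$⟩ʳ_) (v ~_))
  where open Graph G

Point : Set
Point = ℚ × ℚ

OnSegment : Point → Point → Point → Set
OnSegment (px , py) (qx , qy) (x , y) =
  ∃[ t ] 0ℚ ℚ.≤ t × t ℚ.≤ 1ℚ
       × x ≡ (1ℚ ℚ.- t) ℚ.* px ℚ.+ t ℚ.* qx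
       × y ≡ (1ℚ ℚ.- t) ℚ.* py ℚ.+ t ℚ.* qy

-- The parallel lines are normalised to y = 0 and y = 1, with vertex v
-- represented by the segment from (a v , 0) to (b v , 1). Rational
-- coordinates suffice: a finite family of such segments with real endpoints
-- can be replaced by a rational one with the same intersection pattern.
PermutationGraph : ∀ {n} → Graph n → Set
PermutationGraph {n} G =
  Σ[ a ∈ (Fin n → ℚ) ] Σ[ b ∈ (Fin n → ℚ) ] (∀ u v → u ≢ v →
    (u ~ v) ⇔ (∃[ X ] OnSegment (a u , 0ℚ) (b u , 1ℚ) X
                    × OnSegment (a v , 0ℚ) (b v , 1ℚ) X))
  where open Graph G

⟦_⟧ : ∀ {n} {P : U.Pred (Fin n) 0ℓ} → U.Decidable P → Subset n
⟦ P? ⟧ = tabulate (does ∘ P?)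

neighborhood : ∀ {n} → Graph n → Fin n → Subset n
neighborhood G v = ⟦ v ~?_ ⟧
  where open Graph G

colorClass : ∀ {n k} → (Fin n → Fin k) → Fin k → Subset n
colorClass c x = ⟦ (λ v → c v ≟ x) ⟧

Proper : ∀ {n k} → Graph n → (Fin n → Fin k) → Set
Proper G c = ∀ u v → u ~ v → c u ≢ c v
  where open Graph G

NonIsolated : ∀ {n} → Graph n → Fin n → Set
NonIsolated G v = ∃[ w ] v ~ w
  where open Graph G

Odd : ℕ → Set
Odd m = ¬ 2 ∣ m

OddAtNeighborhoods : ∀ {n k} → Graph n → (Fin n → Fin k) → Set
OddAtNeighborhoods G c =
  ∀ v → NonIsolated G v →
  ∃[ x ] Odd ∣ neighborhood G v ∩ colorClass c x ∣

ProperOdd : ∀ {n k} → Graph n → (Fin n → Fin k) → Set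
ProperOdd G c = Proper G c × OddAtNeighborhoods G c

Colorable : ∀ {n} → Graph n → ℕ → Set
Colorable {n} G k = ∃[ c ] Proper {n} {k} G c

OddColorable : ∀ {n} → Graph n → ℕ → Set
OddColorable {n} G k = ∃[ c ] ProperOdd {n} {k} G c

∃-fun? : ∀ {n k} {P : (Fin n → Fin k) → Set} →
         (∀ {f g} → (∀ i → f i ≡ g i) → P f → P g) →
         U.Decidable P → Dec (∃ P)
∃-fun? resp P? = map′
  (λ (i , p) → finToFun i , p)
  (λ (f , p) → funToFin f , resp (λ i → sym (finToFun-funToFin f i)) p)
  (any? (P? ∘ finToFun))

proper-resp : ∀ {n k} (G : Graph n) {c d : Fin n → Fin k} →
              (∀ v → c v ≡ d v) → Proper G c → Proper G d
proper-resp G c≗d p u v u~v du≡dv =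
  p u v u~v (trans (c≗d u) (trans du≡dv (sym (c≗d v))))

∈⟦⟧⁺ : ∀ {n} {P : U.Pred (Fin n) 0ℓ} (P? : U.Decidable P) {x} → P x → x ∈ ⟦ P? ⟧
∈⟦⟧⁺ P? {x} px =
  lookup⇒[]= x _ (trans (lookup∘tabulate _ x) (dec-true (P? x) px))

∈⟦⟧⁻ : ∀ {n} {P : U.Pred (Fin n) 0ℓ} (P? : U.Decidable P) {x} → x ∈ ⟦ P? ⟧ → P x
∈⟦⟧⁻ P? {x} x∈ with P? x | trans (sym (lookup∘tabulate (does ∘ P?) x)) ([]=⇒lookup x∈)
... | yes px | _  = px
... | no _   | ()

colorClass-cong : ∀ {n k} {c d : Fin n → Fin k} → (∀ v → c v ≡ d v) →
                  ∀ x → colorClass c x ≡ colorClass d x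
colorClass-cong {c = c} {d} c≗d x = ⊆-antisym
  (λ v∈ → ∈⟦⟧⁺ (λ v → d v ≟ x) (trans (sym (c≗d _)) (∈⟦⟧⁻ (λ v → c v ≟ x) v∈)))
  (λ v∈ → ∈⟦⟧⁺ (λ v → c v ≟ x) (trans (c≗d _) (∈⟦⟧⁻ (λ v → d v ≟ x) v∈)))

properOdd-resp : ∀ {n k} (G : Graph n) {c d : Fin n → Fin k} →
                 (∀ v → c v ≡ d v) → ProperOdd G c → ProperOdd G d
properOdd-resp G c≗d (p , o) = proper-resp G c≗d p , λ v nv →
  let (x , ox) = o v nv in
  x , subst (λ C → Odd ∣ neighborhood G v ∩ C ∣) (colorClass-cong c≗d x) ox

proper? : ∀ {n k} (G : Graph n) → U.Decidable (Proper {n} {k} G)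
proper? G c = all? λ u → all? λ v → (u ~? v) →-dec ¬? (c u ≟ c v)
  where open Graph G

properOdd? : ∀ {n k} (G : Graph n) → U.Decidable (ProperOdd {n} {k} G)
properOdd? G c = proper? G c ×-dec
  (all? λ v → any? (v ~?_) →-dec
    any? λ x → ¬? (2 ∣? ∣ neighborhood G v ∩ colorClass c x ∣))
  where open Graph G

colorable? : ∀ {n} (G : Graph n) → U.Decidable (Colorable G)
colorable? G k = ∃-fun? (proper-resp G) (proper? G)

oddColorable? : ∀ {n} (G : Graph n) → U.Decidable (OddColorable G)
oddColorable? G k = ∃-fun? (properOdd-resp G) (properOdd? G)

id-proper : ∀ {n} (G : Graph n) → Proper G id
id-proper G u v u~v u≡v = ~-irrefl u≡v u~v
  where open Graph G

id-properOdd : ∀ {n} (G : Graph n) → ProperOdd G id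
id-properOdd {n} G = id-proper G , λ v (w , v~w) →
  w , λ 2∣ → contradiction (∣1⇒≡1 (subst (2 ∣_) (once v w v~w) 2∣)) λ ()
  where
  open Graph G
  once : ∀ v w → v ~ w → ∣ neighborhood G v ∩ colorClass id w ∣ ≡ 1
  once v w v~w = trans (cong ∣_∣ (⊆-antisym to from)) (∣⁅x⁆∣≡1 w)
    where
    to : ∀ {x} → x ∈ neighborhood G v ∩ colorClass id w → x ∈ ⁅ w ⁆
    to {x} x∈ = subst (_∈ ⁅ w ⁆)
      (sym (∈⟦⟧⁻ (_≟ w) (proj₂ (x∈p∩q⁻ (neighborhood G v) _ x∈)))) (x∈⁅x⁆ w)
    from : ∀ {x} → x ∈ ⁅ w ⁆ → x ∈ neighborhood G v ∩ colorClass id w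
    from x∈ with refl ← x∈⁅y⁆⇒x≡y w x∈ =
      x∈p∩q⁺ (∈⟦⟧⁺ (v ~?_) v~w , ∈⟦⟧⁺ (_≟ w) refl)

IsLeast : U.Pred ℕ 0ℓ → ℕ → Set
IsLeast P m = P m × (∀ k → P k → m ≤ k)

least : {P : U.Pred ℕ 0ℓ} → U.Decidable P → ∀ m → P m → ∃ (IsLeast P)
least P? zero    p = zero , p , λ _ _ → z≤n
least {P} P? (suc m) p with P? 0
... | yes p₀ = zero , p₀ , λ _ _ → z≤n
... | no ¬p₀ with least {P ∘ suc} (P? ∘ suc) m p
...   | l , pl , min = suc l , pl , λ where
          zero    p₀ → contradiction p₀ ¬p₀
          (suc k) pk → s≤s (min k pk)

χ-least : ∀ {n} (G : Graph n) → ∃ (IsLeast (Colorable G))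
χ-least {n} G = least (colorable? G) n (id , id-proper G)

χₒ-least : ∀ {n} (G : Graph n) → ∃ (IsLeast (OddColorable G))
χₒ-least {n} G = least (oddColorable? G) n (id , id-properOdd G)

χ : ∀ {n} → Graph n → ℕ
χ = proj₁ ∘ χ-least

χₒ : ∀ {n} → Graph n → ℕ
χₒ = proj₁ ∘ χₒ-least

{-# OPTIONS --safe #-}
-- Two vertices of CP_n are adjacent iff they lie in different pairs of the deleted
-- matching. In the natural cyclic order, N(v) is thus the complement of the length-two
-- arc formed by the pair of v. For the segment model, the order of the vertices on the
-- upper line is obtained from the order on the lower line by reversing the order of the
-- pairs but not the order inside each pair. Colouring by pairs gives χ ≤ n. In a proper
-- odd colouring a colour class meets at most one pair, so a colour that is odd in N(v)
-- forces a bichromatic pair other than the pair of v; taking v inside that pair gives a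
-- second bichromatic pair. One vertex from every pair, together with the remaining
-- vertices of these two pairs, then have n + 2 different colours.
module Submission where

open import Defs
open import Data.Nat using (ℕ; _+_; _≤_; _≥_)
open import Data.Product using (_×_)

open import Data.Bool using (true; false)
open import Data.Fin using (Fin; zero; suc; toℕ; cast; combine; remQuot; opposite)
import Data.Fin as Fin
open import Data.Fin.Patterns using (0F; 1F)
open import Data.Fin.Permutation as Permutation using ()
import Data.Fin.Properties as Fin
open import Data.Fin.Subset using (Subset; _∈_; _∉_; _∪_; _∩_; ∣_∣; ⁅_⁆)
open import Data.Fin.Subset.Properties
  using ( ⊆-antisym; nonempty?; Empty-unique; ∣⊥∣≡0; ∣⁅x⁆∣≡1; ∪-identityˡ
        ; x∈⁅x⁆; x∈⁅y⁆⇒x≡y; x∈p∩q⁺; x∈p∩q⁻; x∈p∪q⁺; x∈p∪q⁻)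
open import Data.Integer using (+_)
import Data.Integer as ℤ
import Data.Integer.Properties as ℤ
open import Data.Nat using (zero; suc; s≤s; _*_; _∸_; _<_; NonZero)
import Data.Nat.Coprimality as Coprimality
open import Data.Nat.Divisibility using (_∣_; ∣-refl; _∣0)
open import Data.Nat.DivMod
  using (_%_; _mod_; m%n<n; m%n%n≡m%n; %-distribˡ-+; m<n⇒m%n≡m; [m+n]%n≡m%n; m≤n⇒[n∸m]%m≡n%m; m%n≤m)
import Data.Nat.Properties as ℕ
open import Data.Product using (∃-syntax; _,_; proj₁; proj₂)
open import Data.Rational as ℚ using (ℚ; mkℚ; 0ℚ; 1ℚ)
import Data.Rational.Properties as ℚ
open import Data.Rational.Solver using (module +-*-Solver)
open import Data.Sum using (_⊎_; inj₁; inj₂)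
open import Data.Vec using (_∷_; here; there)
open import Function using (_∘_)
open import Function.Bundles using (_⇔_; mk⇔)
import Function.Properties.Equivalence as ⇔
open import Relation.Binary using (tri<; tri≈; tri>)
open import Relation.Binary.PropositionalEquality
open import Relation.Nullary using (¬_; yes; no; contradiction)
open import Relation.Nullary.Decidable using (¬?; _×-dec_; decidable-stable)

private variable
  n k : ℕ

-- Arcs of a cycle and residues.

[m%d+n]%d≡[m+n]%d : ∀ m n d .{{_ : NonZero d}} → (m % d + n) % d ≡ (m + n) % d
[m%d+n]%d≡[m+n]%d m n d = begin
  (m % d + n) % d           ≡⟨ %-distribˡ-+ (m % d) n d ⟩
  (m % d % d + n % d) % d   ≡⟨ cong (λ x → (x + n % d) % d) (m%n%n≡m%n m d) ⟩
  (m % d + n % d) % d       ≡⟨ %-distribˡ-+ m n d ⟨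
  (m + n) % d               ∎
  where open ≡-Reasoning

-- `OnArc` adds the offset to an already reduced start and reduces again. Collapsing the two
-- reductions into one allows an unreduced start, in particular `m = N`.
onArc-mod : ∀ {N} .{{_ : NonZero N}} m ℓ (p : Fin N) →
            OnArc (m mod N) ℓ p ⇔ (∃[ i ] i < ℓ × toℕ p ≡ (m + i) % N)
onArc-mod {N} m ℓ p = mk⇔
  (λ (i , i<ℓ , p≡) → i , i<ℓ , trans (cong toℕ p≡) (position i))
  (λ (i , i<ℓ , p≡) → i , i<ℓ , Fin.toℕ-injective (trans p≡ (sym (position i))))
  where
  position : ∀ i → toℕ ((toℕ (m mod N) + i) mod N) ≡ (m + i) % N
  position i = begin
    toℕ ((toℕ (m mod N) + i) mod N)  ≡⟨ Fin.toℕ-fromℕ< _ ⟩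
    (toℕ (m mod N) + i) % N          ≡⟨ cong (λ x → (x + i) % N) (Fin.toℕ-fromℕ< (m%n<n m N)) ⟩
    (m % N + i) % N                  ≡⟨ [m%d+n]%d≡[m+n]%d m i N ⟩
    (m + i) % N                      ∎
    where open ≡-Reasoning

-- Walking from `hi`, the arc covers the `N ∸ hi` positions up to the end, wraps to 0 and covers
-- `lo` more.
complement-onArc : ∀ {N} .{{_ : NonZero N}} lo hi → hi ≤ N → (p : Fin N) →
                   (toℕ p < lo ⊎ hi ≤ toℕ p) ⇔ OnArc (hi mod N) (lo + (N ∸ hi)) p
complement-onArc {N} lo hi hi≤N p =
  ⇔.trans (mk⇔ to from) (⇔.sym (onArc-mod hi (lo + (N ∸ hi)) p))
  where
  p%N : toℕ p % N ≡ toℕ p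
  p%N = m<n⇒m%n≡m (Fin.toℕ<n p)

  -- The offset `m + (N ∸ hi)` from `hi` reaches `m` after exactly one full turn.
  shift : ∀ m → hi + (m + (N ∸ hi)) ≡ m + N
  shift m = begin
    hi + (m + (N ∸ hi))  ≡⟨ ℕ.+-comm hi _ ⟩
    m + (N ∸ hi) + hi    ≡⟨ ℕ.+-assoc m (N ∸ hi) hi ⟩
    m + (N ∸ hi + hi)    ≡⟨ cong (λ x → m + x) (ℕ.m∸n+n≡m hi≤N) ⟩
    m + N                ∎
    where open ≡-Reasoning

  to : toℕ p < lo ⊎ hi ≤ toℕ p → ∃[ i ] i < lo + (N ∸ hi) × toℕ p ≡ (hi + i) % N
  to (inj₁ p<lo) = toℕ p + (N ∸ hi) , ℕ.+-monoˡ-< (N ∸ hi) p<lo ,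
    sym (trans (cong (_% N) (shift (toℕ p))) (trans ([m+n]%n≡m%n (toℕ p) N) p%N))
  to (inj₂ hi≤p) = toℕ p ∸ hi ,
    ℕ.<-≤-trans (ℕ.∸-monoˡ-< (Fin.toℕ<n p) hi≤p) (ℕ.m≤n+m (N ∸ hi) lo) ,
    sym (trans (cong (_% N) (ℕ.m+[n∸m]≡n hi≤p)) p%N)

  from : ∃[ i ] i < lo + (N ∸ hi) × toℕ p ≡ (hi + i) % N → toℕ p < lo ⊎ hi ≤ toℕ p
  from (i , i<ℓ , p≡) with hi + i ℕ.<? N
  ... | yes hi+i<N = inj₂ (subst (hi ≤_) (sym (trans p≡ (m<n⇒m%n≡m hi+i<N))) (ℕ.m≤m+n hi i))
  -- Past the wrap the residue is at most `hi + i ∸ N`, and `i<ℓ` keeps this below `lo`.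
  ... | no hi+i≮N = inj₁ (begin-strict
    toℕ p                          ≡⟨ p≡ ⟩
    (hi + i) % N                   ≡⟨ m≤n⇒[n∸m]%m≡n%m N≤hi+i ⟨
    (hi + i ∸ N) % N               ≤⟨ m%n≤m (hi + i ∸ N) N ⟩
    hi + i ∸ N                     <⟨ ℕ.∸-monoˡ-< (ℕ.+-monoʳ-< hi i<ℓ) N≤hi+i ⟩
    hi + (lo + (N ∸ hi)) ∸ N       ≡⟨ cong (_∸ N) (shift lo) ⟩
    lo + N ∸ N                     ≡⟨ ℕ.m+n∸n≡m lo N ⟩
    lo                             ∎)
    where
    open ℕ.≤-Reasoning
    N≤hi+i : N ≤ hi + i
    N≤hi+i = ℕ.≮⇒≥ hi+i≮N

-- Intersection of segments between two parallel lines.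

Meet : (a b a′ b′ : ℚ) → Set
Meet a b a′ b′ = ∃[ X ] OnSegment (a , 0ℚ) (b , 1ℚ) X × OnSegment (a′ , 0ℚ) (b′ , 1ℚ) X

meet-sym : ∀ {a b a′ b′} → Meet a b a′ b′ → Meet a′ b′ a b
meet-sym (X , p , q) = X , q , p

p<q⇒0<q-p : ∀ {p q} → p ℚ.< q → 0ℚ ℚ.< q ℚ.- p
p<q⇒0<q-p {p} {q} p<q = subst (ℚ._< q ℚ.- p) (ℚ.+-inverseʳ p) (ℚ.+-monoˡ-< (ℚ.- p) p<q)

p≤q⇒0≤q-p : ∀ {p q} → p ℚ.≤ q → 0ℚ ℚ.≤ q ℚ.- p
p≤q⇒0≤q-p {p} {q} p≤q = subst (ℚ._≤ q ℚ.- p) (ℚ.+-inverseʳ p) (ℚ.+-monoˡ-≤ (ℚ.- p) p≤q)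

-- The horizontal gap between the segments is affine in the height, going from `p > 0` at height 0
-- to `- q ≤ 0` at height 1. It vanishes at `t = p / (p + q)`, and strictness on the lower line
-- makes the denominator positive.
crossing⇒meet : ∀ {a b a′ b′} → a ℚ.< a′ → b′ ℚ.≤ b → Meet a b a′ b′
crossing⇒meet {a} {b} {a′} {b′} a<a′ b′≤b =
  (_ , _) , (t , 0≤t , t≤1 , refl , refl) , (t , 0≤t , t≤1 , agree , refl)
  where
  p q d : ℚ
  p = a′ ℚ.- a
  q = b ℚ.- b′
  d = p ℚ.+ q
  instance
    p>0 : ℚ.Positive p
    p>0 = ℚ.positive (p<q⇒0<q-p a<a′)
    q≥0 : ℚ.NonNegative q
    q≥0 = ℚ.nonNegative (p≤q⇒0≤q-p b′≤b)
    d>0 : ℚ.Positive d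
    d>0 = ℚ.pos+nonNeg⇒pos p q
    d≢0 : ℚ.NonZero d
    d≢0 = ℚ.pos⇒nonZero d
  r : ℚ
  r = ℚ.1/ d
  instance
    r>0 : ℚ.Positive r
    r>0 = ℚ.1/pos⇒pos d
    r≥0 : ℚ.NonNegative r
    r≥0 = ℚ.pos⇒nonNeg r
    pr>0 : ℚ.Positive (p ℚ.* r)
    pr>0 = ℚ.pos*pos⇒pos p r
  t : ℚ
  t = p ℚ.* r
  0≤t : 0ℚ ℚ.≤ t
  0≤t = ℚ.<⇒≤ (ℚ.positive⁻¹ t)
  p≤d : p ℚ.≤ d
  p≤d = subst (ℚ._≤ d) (ℚ.+-identityʳ p) (ℚ.+-monoʳ-≤ p (ℚ.nonNegative⁻¹ q))
  t≤1 : t ℚ.≤ 1ℚ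
  t≤1 = subst (t ℚ.≤_) (ℚ.*-inverseʳ d) (ℚ.*-monoʳ-≤-nonNeg r p≤d)
  td≡p : t ℚ.* d ≡ p
  td≡p = trans (ℚ.*-assoc p r d) (trans (cong (p ℚ.*_) (ℚ.*-inverseˡ d)) (ℚ.*-identityʳ p))
  agree : (1ℚ ℚ.- t) ℚ.* a ℚ.+ t ℚ.* b ≡ (1ℚ ℚ.- t) ℚ.* a′ ℚ.+ t ℚ.* b′
  agree = begin
    (1ℚ ℚ.- t) ℚ.* a ℚ.+ t ℚ.* b
      -- The two abscissae differ by `t * d - p`, which is zero by the choice of `t`.
      ≡⟨ solve 5 (λ t a b a′ b′ →
           (con 1ℚ :- t) :* a :+ t :* b :=
           ((con 1ℚ :- t) :* a′ :+ t :* b′) :+ (t :* ((a′ :- a) :+ (b :- b′)) :- (a′ :- a)))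
           refl t a b a′ b′ ⟩
    x′ ℚ.+ (t ℚ.* d ℚ.- p)
      ≡⟨ cong (λ y → x′ ℚ.+ (y ℚ.- p)) td≡p ⟩
    x′ ℚ.+ (p ℚ.- p)
      ≡⟨ cong (x′ ℚ.+_) (ℚ.+-inverseʳ p) ⟩
    x′ ℚ.+ 0ℚ
      ≡⟨ ℚ.+-identityʳ x′ ⟩
    x′ ∎
    where
    open ≡-Reasoning
    open +-*-Solver
    x′ = (1ℚ ℚ.- t) ℚ.* a′ ℚ.+ t ℚ.* b′

-- At least one of the two weights is positive, and strictness comes from that summand: from the
-- first when `t` is 0, from the second when `t` is positive.
convex-mono-< : ∀ {t a b a′ b′} → 0ℚ ℚ.≤ t → t ℚ.≤ 1ℚ → a ℚ.< a′ → b ℚ.< b′ →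
                (1ℚ ℚ.- t) ℚ.* a ℚ.+ t ℚ.* b ℚ.< (1ℚ ℚ.- t) ℚ.* a′ ℚ.+ t ℚ.* b′
convex-mono-< {t} 0≤t t≤1 a<a′ b<b′ with ℚ.<-cmp 0ℚ t
... | tri> _ _ t<0 = contradiction (ℚ.<-≤-trans t<0 0≤t) (ℚ.<-irrefl refl)
... | tri≈ _ refl _ = ℚ.+-mono-<-≤
  (ℚ.*-monoʳ-<-pos (1ℚ ℚ.- 0ℚ) a<a′) (ℚ.*-monoˡ-≤-nonNeg 0ℚ (ℚ.<⇒≤ b<b′))
... | tri< 0<t _ _ = ℚ.+-mono-≤-<
  (ℚ.*-monoˡ-≤-nonNeg (1ℚ ℚ.- t) {{ℚ.nonNegative (p≤q⇒0≤q-p t≤1)}} (ℚ.<⇒≤ a<a′))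
  (ℚ.*-monoʳ-<-pos t {{ℚ.positive 0<t}} b<b′)

height : ∀ t → (1ℚ ℚ.- t) ℚ.* 0ℚ ℚ.+ t ℚ.* 1ℚ ≡ t
height = solve 1 (λ t → (con 1ℚ :- t) :* con 0ℚ :+ t :* con 1ℚ := t) refl
  where open +-*-Solver

-- The height of a point on a segment equals its parameter, so a common point has the same parameter
-- on both segments. At equal parameters the abscissae are strictly ordered.
parallel⇒¬meet : ∀ {a b a′ b′} → a ℚ.< a′ → b ℚ.< b′ → ¬ Meet a b a′ b′
parallel⇒¬meet a<a′ b<b′ (_ , (t , 0≤t , t≤1 , x≡ , y≡) , (t′ , _ , _ , x≡′ , y≡′))
  with refl ← trans (sym (height t)) (trans (sym y≡) (trans y≡′ (height t′)))
  = ℚ.<⇒≢ (convex-mono-< 0≤t t≤1 a<a′ b<b′) (trans (sym x≡) x≡′)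

-- The reduced fraction with denominator 1, given directly so that comparison unfolds to integers;
-- `mkℚ` stores the denominator minus one, hence the 0.
fromℕ : ℕ → ℚ
fromℕ m = mkℚ (+ m) 0 (Coprimality.sym (Coprimality.1-coprimeTo m))

fromℕ-mono-< : ∀ {m n} → m < n → fromℕ m ℚ.< fromℕ n
fromℕ-mono-< m<n = ℚ.*<* (ℤ.*-monoʳ-<-pos (+ 1) (ℤ.+<+ m<n))

opposite-anti-< : {i j : Fin n} → i Fin.< j → opposite j Fin.< opposite i
opposite-anti-< {n} {i} {j} i<j = subst₂ _<_
  (sym (Fin.opposite-prop j)) (sym (Fin.opposite-prop i))
  (ℕ.∸-monoʳ-< (s≤s i<j) (Fin.toℕ<n j))

-- Cardinality of two-element subsets.

x∉p⇒∣⁅x⁆∪p∣≡1+∣p∣ : (x : Fin n) (p : Subset n) → x ∉ p → ∣ ⁅ x ⁆ ∪ p ∣ ≡ suc ∣ p ∣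
x∉p⇒∣⁅x⁆∪p∣≡1+∣p∣ zero    (true  ∷ p) x∉p = contradiction here x∉p
x∉p⇒∣⁅x⁆∪p∣≡1+∣p∣ zero    (false ∷ p) x∉p = cong (suc ∘ ∣_∣) (∪-identityˡ p)
x∉p⇒∣⁅x⁆∪p∣≡1+∣p∣ (suc x) (true  ∷ p) x∉p = cong suc (x∉p⇒∣⁅x⁆∪p∣≡1+∣p∣ x p (x∉p ∘ there))
x∉p⇒∣⁅x⁆∪p∣≡1+∣p∣ (suc x) (false ∷ p) x∉p = x∉p⇒∣⁅x⁆∪p∣≡1+∣p∣ x p (x∉p ∘ there)

x≢y⇒∣⁅x⁆∪⁅y⁆∣≡2 : {x y : Fin n} → x ≢ y → ∣ ⁅ x ⁆ ∪ ⁅ y ⁆ ∣ ≡ 2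
x≢y⇒∣⁅x⁆∪⁅y⁆∣≡2 {x = x} {y} x≢y = trans
  (x∉p⇒∣⁅x⁆∪p∣≡1+∣p∣ x ⁅ y ⁆ (x≢y ∘ x∈⁅y⁆⇒x≡y y)) (cong suc (∣⁅x⁆∣≡1 y))

another : n ≥ 2 → (i : Fin n) → ∃[ j ] i ≢ j
another (s≤s (s≤s _)) zero    = 1F , λ ()
another (s≤s (s≤s _)) (suc i) = 0F , λ ()

-- Coordinates of a vertex: its matching pair and its side within the pair.

module CocktailParty (n : ℕ) where

  -- `combine i b` has value `2 * i + b` but lives in `Fin (n * 2)`, hence the cast.
  vertex : Fin n → Fin 2 → Fin (2 * n)
  vertex i b = cast (ℕ.*-comm n 2) (combine i b)

  coordinates : Fin (2 * n) → Fin n × Fin 2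
  coordinates v = remQuot {n} 2 (cast (ℕ.*-comm 2 n) v)

  pair : Fin (2 * n) → Fin n
  pair = proj₁ ∘ coordinates

  side : Fin (2 * n) → Fin 2
  side = proj₂ ∘ coordinates

  vertex-coordinates : (v : Fin (2 * n)) → vertex (pair v) (side v) ≡ v
  vertex-coordinates v = trans
    (cong (cast (ℕ.*-comm n 2)) (Fin.combine-remQuot {n} 2 (cast (ℕ.*-comm 2 n) v)))
    (Fin.cast-involutive (ℕ.*-comm n 2) (ℕ.*-comm 2 n) v)

  coordinates-vertex : (i : Fin n) (b : Fin 2) → coordinates (vertex i b) ≡ (i , b)
  coordinates-vertex i b = trans
    (cong (remQuot 2) (Fin.cast-involutive (ℕ.*-comm 2 n) (ℕ.*-comm n 2) (combine i b)))
    (Fin.remQuot-combine i b)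

  pair-vertex : (i : Fin n) (b : Fin 2) → pair (vertex i b) ≡ i
  pair-vertex i b = cong proj₁ (coordinates-vertex i b)

  side-vertex : (i : Fin n) (b : Fin 2) → side (vertex i b) ≡ b
  side-vertex i b = cong proj₂ (coordinates-vertex i b)

  toℕ-vertex : (i : Fin n) (b : Fin 2) → toℕ (vertex i b) ≡ 2 * toℕ i + toℕ b
  toℕ-vertex i b = trans (Fin.toℕ-cast _ (combine i b)) (Fin.toℕ-combine i b)

  toℕ-coordinates : (v : Fin (2 * n)) → toℕ v ≡ 2 * toℕ (pair v) + toℕ (side v)
  toℕ-coordinates v = trans (cong toℕ (sym (vertex-coordinates v))) (toℕ-vertex _ _)

  pair-unique : (v : Fin (2 * n)) (i : Fin n) (b : Fin 2) →
                toℕ v ≡ 2 * toℕ i + toℕ b → pair v ≡ i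
  pair-unique v i b v≡ = trans
    (cong pair (Fin.toℕ-injective (trans v≡ (sym (toℕ-vertex i b)))))
    (pair-vertex i b)

  coordinates-injective : (u v : Fin (2 * n)) →
                          pair u ≡ pair v → side u ≡ side v → u ≡ v
  coordinates-injective u v p s =
    trans (sym (vertex-coordinates u)) (trans (cong₂ vertex p s) (vertex-coordinates v))

  2*pair≤ : (v : Fin (2 * n)) → 2 * toℕ (pair v) ≤ toℕ v
  2*pair≤ v = subst (2 * toℕ (pair v) ≤_) (sym (toℕ-coordinates v)) (ℕ.m≤m+n _ (toℕ (side v)))

  <2*suc-pair : (v : Fin (2 * n)) → toℕ v < 2 * suc (toℕ (pair v))
  <2*suc-pair v = begin-strict
    toℕ v                            ≡⟨ toℕ-coordinates v ⟩
    2 * toℕ (pair v) + toℕ (side v)  <⟨ ℕ.+-monoʳ-< _ (Fin.toℕ<n (side v)) ⟩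
    2 * toℕ (pair v) + 2             ≡⟨ ℕ.+-comm _ 2 ⟩
    2 + 2 * toℕ (pair v)             ≡⟨ ℕ.*-suc 2 (toℕ (pair v)) ⟨
    2 * suc (toℕ (pair v))           ∎
    where open ℕ.≤-Reasoning

  pair-<⇒< : (u v : Fin (2 * n)) → pair u Fin.< pair v → u Fin.< v
  pair-<⇒< u v p<q =
    ℕ.<-≤-trans (<2*suc-pair u) (ℕ.≤-trans (ℕ.*-monoʳ-≤ 2 p<q) (2*pair≤ v))

  side-<⇒< : (u v : Fin (2 * n)) → pair u ≡ pair v → side u Fin.< side v → u Fin.< v
  side-<⇒< u v p≡q s<t = subst₂ _<_
    (sym (toℕ-coordinates u))
    (sym (trans (toℕ-coordinates v) (cong (λ i → 2 * toℕ i + toℕ (side v)) (sym p≡q))))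
    (ℕ.+-monoʳ-< (2 * toℕ (pair u)) s<t)

  -- Adjacency in terms of pairs.

  matched⇒pair-≡ : (u v : Fin (2 * n)) → Matched n u v → pair u ≡ pair v
  matched⇒pair-≡ u v (i , inj₁ (u≡ , v≡)) = trans
    (pair-unique u i 0F (trans u≡ (sym (ℕ.+-identityʳ _)))) (sym (pair-unique v i 1F v≡))
  matched⇒pair-≡ u v (i , inj₂ (v≡ , u≡)) = trans
    (pair-unique u i 1F u≡) (sym (pair-unique v i 0F (trans v≡ (sym (ℕ.+-identityʳ _)))))

  pair-≡⇒matched : (u v : Fin (2 * n)) → pair u ≡ pair v →
                   side u ≡ 0F → side v ≡ 1F → Matched n u v
  pair-≡⇒matched u v p≡q su sv = pair u , inj₁
    ( trans (toℕ-coordinates u) (trans (cong (λ b → 2 * toℕ (pair u) + toℕ b) su) (ℕ.+-identityʳ _))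
    , trans (toℕ-coordinates v) (cong₂ (λ i b → 2 * toℕ i + toℕ b) (sym p≡q) sv))

  open Graph (CP n) using (_~_; _~?_)

  -- Within one pair, equal sides give equal vertices and different sides give a deleted edge.
  ~⇒pair-≢ : (u v : Fin (2 * n)) → u ~ v → pair u ≢ pair v
  ~⇒pair-≢ u v (u≢v , ¬M) p≡q with side u in su | side v in sv
  ... | 0F | 0F = u≢v (coordinates-injective u v p≡q (trans su (sym sv)))
  ... | 0F | 1F = ¬M (pair-≡⇒matched u v p≡q su sv)
  ... | 1F | 0F = ¬M (matched-sym n (pair-≡⇒matched v u (sym p≡q) sv su))
  ... | 1F | 1F = u≢v (coordinates-injective u v p≡q (trans su (sym sv)))

  pair-≢⇒~ : (u v : Fin (2 * n)) → pair u ≢ pair v → u ~ v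
  pair-≢⇒~ u v p≢q = (λ u≡v → p≢q (cong pair u≡v)) , p≢q ∘ matched⇒pair-≡ u v

  ~⇔pair-≢ : (u v : Fin (2 * n)) → u ~ v ⇔ pair u ≢ pair v
  ~⇔pair-≢ u v = mk⇔ (~⇒pair-≢ u v) (pair-≢⇒~ u v)

  -- Convex-roundness.

  pair-≢⇔outside : (v u : Fin (2 * n)) →
    pair v ≢ pair u ⇔ (toℕ u < 2 * toℕ (pair v) ⊎ 2 * suc (toℕ (pair v)) ≤ toℕ u)
  pair-≢⇔outside v u = mk⇔ to from
    where
    to : pair v ≢ pair u → toℕ u < 2 * toℕ (pair v) ⊎ 2 * suc (toℕ (pair v)) ≤ toℕ u
    to p≢q with Fin.<-cmp (pair v) (pair u)
    ... | tri< p<q _ _ = inj₂ (ℕ.≤-trans (ℕ.*-monoʳ-≤ 2 p<q) (2*pair≤ u))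
    ... | tri≈ _ p≡q _ = contradiction p≡q p≢q
    ... | tri> _ _ q<p = inj₁ (ℕ.<-≤-trans (<2*suc-pair u) (ℕ.*-monoʳ-≤ 2 q<p))

    from : toℕ u < 2 * toℕ (pair v) ⊎ 2 * suc (toℕ (pair v)) ≤ toℕ u → pair v ≢ pair u
    from (inj₁ u<) p≡q =
      ℕ.<⇒≱ u< (subst (λ i → 2 * toℕ i ≤ toℕ u) (sym p≡q) (2*pair≤ u))
    from (inj₂ ≤u) p≡q =
      ℕ.<⇒≱ (<2*suc-pair u) (subst (λ i → 2 * suc (toℕ i) ≤ toℕ u) p≡q ≤u)

  CP-convexRound : ConvexRound (CP n)
  CP-convexRound = Permutation.id , λ v →
    -- The existence of `v` shows that `2 * n` is nonzero, as `mod` requires.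
    let instance _ = Fin.nonZeroIndex v in
    -- The arc starts just after the pair of `v`; for the last pair this is `2 * n`, which wraps to
    -- 0.
    2 * suc (toℕ (pair v)) mod (2 * n) ,
    2 * toℕ (pair v) + (2 * n ∸ 2 * suc (toℕ (pair v))) , λ u →
    ⇔.trans (~⇔pair-≢ v u) (⇔.trans (pair-≢⇔outside v u)
      (complement-onArc (2 * toℕ (pair v)) (2 * suc (toℕ (pair v)))
        (ℕ.*-monoʳ-≤ 2 (Fin.toℕ<n (pair v))) u))

  -- The segment model.

  reflect : Fin (2 * n) → Fin (2 * n)
  reflect v = vertex (opposite (pair v)) (side v)

  reflect-anti-< : (u v : Fin (2 * n)) → pair u Fin.< pair v → reflect v Fin.< reflect u
  reflect-anti-< u v p<q = pair-<⇒< (reflect v) (reflect u)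
    (subst₂ Fin._<_ (sym (pair-vertex _ _)) (sym (pair-vertex _ _)) (opposite-anti-< p<q))

  reflect-mono-< : (u v : Fin (2 * n)) → pair u ≡ pair v → side u Fin.< side v →
                   reflect u Fin.< reflect v
  reflect-mono-< u v p≡q s<t = side-<⇒< (reflect u) (reflect v)
    (trans (pair-vertex _ _) (trans (cong opposite p≡q) (sym (pair-vertex _ _))))
    (subst₂ Fin._<_ (sym (side-vertex _ _)) (sym (side-vertex _ _)) s<t)

  -- Segments from different pairs change their order between the two lines and so cross; segments
  -- from the same pair keep it and so stay disjoint.
  CP-permutation : PermutationGraph (CP n)
  CP-permutation = bottom , top , λ u v u≢v →
    ⇔.trans (~⇔pair-≢ u v) (mk⇔ (meet u v) (λ m p≡q → disjoint u v u≢v p≡q m))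
    where
    bottom top : Fin (2 * n) → ℚ
    bottom v = fromℕ (toℕ v)
    top v = fromℕ (toℕ (reflect v))

    meet-< : ∀ u v → pair u Fin.< pair v → Meet (bottom u) (top u) (bottom v) (top v)
    meet-< u v p<q = crossing⇒meet (fromℕ-mono-< (pair-<⇒< u v p<q))
      (ℚ.<⇒≤ (fromℕ-mono-< (reflect-anti-< u v p<q)))

    meet : ∀ u v → pair u ≢ pair v → Meet (bottom u) (top u) (bottom v) (top v)
    meet u v p≢q with Fin.<-cmp (pair u) (pair v)
    ... | tri< p<q _ _ = meet-< u v p<q
    ... | tri≈ _ p≡q _ = contradiction p≡q p≢q
    ... | tri> _ _ q<p = meet-sym (meet-< v u q<p)

    disjoint-< : ∀ u v → pair u ≡ pair v → side u Fin.< side v →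
                 ¬ Meet (bottom u) (top u) (bottom v) (top v)
    disjoint-< u v p≡q s<t = parallel⇒¬meet (fromℕ-mono-< (side-<⇒< u v p≡q s<t))
      (fromℕ-mono-< (reflect-mono-< u v p≡q s<t))

    disjoint : ∀ u v → u ≢ v → pair u ≡ pair v → ¬ Meet (bottom u) (top u) (bottom v) (top v)
    disjoint u v u≢v p≡q with Fin.<-cmp (side u) (side v)
    ... | tri< s<t _ _ = disjoint-< u v p≡q s<t
    ... | tri≈ _ s≡t _ = contradiction (coordinates-injective u v p≡q s≡t) u≢v
    ... | tri> _ _ t<s = disjoint-< v u (sym p≡q) t<s ∘ meet-sym

  -- Upper bound for the chromatic number.

  χ≤n : χ (CP n) ≤ n
  χ≤n = proj₂ (proj₂ (χ-least (CP n))) n (pair , ~⇒pair-≢)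

  -- Lower bound for the odd chromatic number.

  proper-pair : (c : Fin (2 * n) → Fin k) → Proper (CP n) c →
                ∀ u v → c u ≡ c v → pair u ≡ pair v
  proper-pair c prop u v cu≡cv = decidable-stable (pair u Fin.≟ pair v)
    λ p≢q → prop u v (pair-≢⇒~ u v p≢q) cu≡cv

  Split : (Fin (2 * n) → Fin k) → Fin n → Set
  Split c i = c (vertex i 0F) ≢ c (vertex i 1F)

  unsplit-color : (c : Fin (2 * n) → Fin k) (w : Fin (2 * n)) → ¬ Split c (pair w) →
                  ∀ b → c (vertex (pair w) b) ≡ c w
  unsplit-color c w ¬split b =
    trans (same b (side w)) (cong c (vertex-coordinates w))
    where
    c₀≡c₁ : c (vertex (pair w) 0F) ≡ c (vertex (pair w) 1F)
    c₀≡c₁ = decidable-stable (_ Fin.≟ _) ¬split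
    same : ∀ b b′ → c (vertex (pair w) b) ≡ c (vertex (pair w) b′)
    same 0F 0F = refl
    same 0F 1F = c₀≡c₁
    same 1F 0F = sym c₀≡c₁
    same 1F 1F = refl

  -- A colour class is independent, so it lies within one pair; if no pair in the
  -- neighbourhood of v is split, it meets the neighbourhood in a whole pair or not at all.
  unsplit⇒even : (c : Fin (2 * n) → Fin k) → Proper (CP n) c → ∀ v →
                 (∀ i → pair v ≢ i → ¬ Split c i) →
                 ∀ x → 2 ∣ ∣ neighborhood (CP n) v ∩ colorClass c x ∣
  unsplit⇒even c prop v unsplit x
    with nonempty? (neighborhood (CP n) v ∩ colorClass c x)
  ... | no empty = subst (2 ∣_)
    (sym (trans (cong ∣_∣ (Empty-unique empty)) (∣⊥∣≡0 (2 * n)))) (2 ∣0)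
  ... | yes (w , w∈) = subst (2 ∣_) (sym (trans (cong ∣_∣ (⊆-antisym to from))
    (x≢y⇒∣⁅x⁆∪⁅y⁆∣≡2 w₀≢w₁))) ∣-refl
    where
    S = neighborhood (CP n) v ∩ colorClass c x
    w₀ = vertex (pair w) 0F
    w₁ = vertex (pair w) 1F

    ∈S⁻ : ∀ {u} → u ∈ S → pair v ≢ pair u × c u ≡ x
    ∈S⁻ {u} u∈ = let u∈N , u∈C = x∈p∩q⁻ (neighborhood (CP n) v) (colorClass c x) u∈ in
      ~⇒pair-≢ v u (∈⟦⟧⁻ (v ~?_) u∈N) , ∈⟦⟧⁻ (λ z → c z Fin.≟ x) u∈C

    ∈S⁺ : ∀ {u} → pair v ≢ pair u → c u ≡ x → u ∈ S
    ∈S⁺ {u} p≢q cu≡x = x∈p∩q⁺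
      (∈⟦⟧⁺ (v ~?_) (pair-≢⇒~ v u p≢q) , ∈⟦⟧⁺ (λ z → c z Fin.≟ x) cu≡x)

    w₀≢w₁ : w₀ ≢ w₁
    w₀≢w₁ eq with () ← trans (sym (side-vertex (pair w) 0F))
                        (trans (cong side eq) (side-vertex (pair w) 1F))

    to : ∀ {u} → u ∈ S → u ∈ ⁅ w₀ ⁆ ∪ ⁅ w₁ ⁆
    to {u} u∈ = subst (_∈ ⁅ w₀ ⁆ ∪ ⁅ w₁ ⁆)
      (trans (cong (λ i → vertex i (side u)) (sym same-pair)) (vertex-coordinates u))
      (member (side u))
      where
      same-pair : pair u ≡ pair w
      same-pair = proper-pair c prop u w (trans (proj₂ (∈S⁻ u∈)) (sym (proj₂ (∈S⁻ w∈))))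
      member : ∀ b → vertex (pair w) b ∈ ⁅ w₀ ⁆ ∪ ⁅ w₁ ⁆
      member 0F = x∈p∪q⁺ (inj₁ (x∈⁅x⁆ w₀))
      member 1F = x∈p∪q⁺ (inj₂ (x∈⁅x⁆ w₁))

    -- The pair of `w` lies in the neighbourhood of `v`, so it is not split and both its vertices
    -- carry the colour of `w`.
    vertex∈S : ∀ b → vertex (pair w) b ∈ S
    vertex∈S b = ∈S⁺
      (subst (pair v ≢_) (sym (pair-vertex (pair w) b)) (proj₁ (∈S⁻ w∈)))
      (trans (unsplit-color c w (unsplit (pair w) (proj₁ (∈S⁻ w∈))) b) (proj₂ (∈S⁻ w∈)))

    from : ∀ {u} → u ∈ ⁅ w₀ ⁆ ∪ ⁅ w₁ ⁆ → u ∈ S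
    from {u} u∈ with x∈p∪q⁻ ⁅ w₀ ⁆ ⁅ w₁ ⁆ u∈
    ... | inj₁ u∈₀ = subst (_∈ S) (sym (x∈⁅y⁆⇒x≡y w₀ u∈₀)) (vertex∈S 0F)
    ... | inj₂ u∈₁ = subst (_∈ S) (sym (x∈⁅y⁆⇒x≡y w₁ u∈₁)) (vertex∈S 1F)

  -- If no pair other than `m` were split, every colour would be even around a vertex of pair `m`. A
  -- second pair, available since `n ≥ 2`, makes that vertex non-isolated, so some colour must be
  -- odd there.
  exists-split : n ≥ 2 → (c : Fin (2 * n) → Fin k) → ProperOdd (CP n) c →
                 ∀ m → ∃[ i ] m ≢ i × Split c i
  exists-split n≥2 c (prop , odd) m
    with Fin.any? (λ i → ¬? (m Fin.≟ i) ×-dec ¬? (c (vertex i 0F) Fin.≟ c (vertex i 1F)))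
  ... | yes found = found
  ... | no ¬found = contradiction
    (unsplit⇒even c prop v (λ i p≢i split → ¬found (i , p≢i ∘ trans (pair-vertex m 0F) , split)) x)
    ox
    where
    v = vertex m 0F
    nonIsolated : NonIsolated (CP n) v
    nonIsolated = let j , m≢j = another n≥2 m in
      vertex j 0F , pair-≢⇒~ v (vertex j 0F)
        (subst₂ _≢_ (sym (pair-vertex m 0F)) (sym (pair-vertex j 0F)) m≢j)
    x = proj₁ (odd v nonIsolated)
    ox = proj₂ (odd v nonIsolated)

  -- The `2 + n` chosen vertices have distinct colours: a repeated colour forces a common pair, and
  -- the only pairs contributing both vertices are `i` and `j`, which are split.
  two-splits⇒2+n≤k : (c : Fin (2 * n) → Fin k) → Proper (CP n) c → ∀ {i j} → i ≢ j →
                     Split c i → Split c j → 2 + n ≤ k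
  two-splits⇒2+n≤k {k} c prop {i} {j} i≢j split-i split-j =
    Fin.injective⇒≤ {f = color} (injective _ _)
    where
    color : Fin (2 + n) → Fin k
    color zero          = c (vertex i 1F)
    color (suc zero)    = c (vertex j 1F)
    color (suc (suc l)) = c (vertex l 0F)

    same-pair : ∀ {l m b b′} → c (vertex l b) ≡ c (vertex m b′) → l ≡ m
    same-pair {l} {m} {b} {b′} eq = trans (sym (pair-vertex l b))
      (trans (proper-pair c prop (vertex l b) (vertex m b′) eq) (pair-vertex m b′))

    split⇒≢ : ∀ {l m} → Split c l → c (vertex l 1F) ≢ c (vertex m 0F)
    split⇒≢ {l} {m} split eq with refl ← same-pair {l} {m} eq = split (sym eq)

    injective : ∀ l m → color l ≡ color m → l ≡ m
    injective zero          zero          eq = refl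
    injective zero          (suc zero)    eq = contradiction (same-pair eq) i≢j
    injective zero          (suc (suc m)) eq = contradiction eq (split⇒≢ split-i)
    injective (suc zero)    zero          eq = contradiction (same-pair (sym eq)) i≢j
    injective (suc zero)    (suc zero)    eq = refl
    injective (suc zero)    (suc (suc m)) eq = contradiction eq (split⇒≢ split-j)
    injective (suc (suc l)) zero          eq = contradiction (sym eq) (split⇒≢ split-i)
    injective (suc (suc l)) (suc zero)    eq = contradiction (sym eq) (split⇒≢ split-j)
    injective (suc (suc l)) (suc (suc m)) eq = cong (λ i → suc (suc i)) (same-pair eq)

  2+n≤χₒ : n ≥ 2 → 2 + n ≤ χₒ (CP n)
  -- Matching on `s≤s` exposes `n` as a successor, so that `zero` is a pair to start from. The
  -- second search excludes the first pair found, which makes the two distinct.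
  2+n≤χₒ n≥2@(s≤s _) =
    let c , podd = proj₁ (proj₂ (χₒ-least (CP n)))
        i , _ , split-i = exists-split n≥2 c podd zero
        j , i≢j , split-j = exists-split n≥2 c podd i
    in two-splits⇒2+n≤k c (proj₁ podd) i≢j split-i split-j

proposition3p5 : (n : ℕ) → n ≥ 2 →
    ConvexRound (CP n) × PermutationGraph (CP n) × (χ (CP n) + 2 ≤ χₒ (CP n))
proposition3p5 n n≥2 = CP-convexRound , CP-permutation , (begin
  χ (CP n) + 2  ≤⟨ ℕ.+-monoˡ-≤ 2 χ≤n ⟩
  n + 2         ≡⟨ ℕ.+-comm n 2 ⟩
  2 + n         ≤⟨ 2+n≤χₒ n≥2 ⟩
  χₒ (CP n)     ∎)
  where
  open CocktailParty n
  open ℕ.≤-Reasoning
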